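{- Let $p$ be an odd prime, let $m \geq 1$ and let $a_1, a_2, \ldots, a_m \in \mathbb{Z}_p$. The quadratic form $\sum_{i=1}^{m} a_i X_i^2$ is universal over $M_2(\mathbb{Z}_p)$ if and only if at least two of the numbers $a_1, a_2, \ldots, a_m$ (counted by index) are units in $\mathbb{Z}_p$.
   Context: $\mathbb{Z}_p$ is the ring of $p$-adic integers and $M_2(R)$ is the ring of $2 \times 2$ matrices over $R$. A form $\sum_{i=1}^m a_i X_i^2$ with $a_i \in R$ is universal over $M_n(R)$ if for every $A \in M_n(R)$ there exist $X_1, \ldots, X_m \in M_n(R)$ with $A = \sum_{i=1}^m a_i X_i^2$. -}

module Defs where

open import Algebra.Bundles using (CommutativeRing; RawMonoid)
import Algebra.Definitions
import Algebra.Definitions.RawMonoid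
open import Data.Fin using (Fin)
open import Data.Integer using (ℤ; +_; -_; _+_; _*_; _-_; 0ℤ; 1ℤ)
open import Data.Integer.Divisibility.Signed
  using (_∣_; divides; ∣m∣n⇒∣m+n; ∣m⇒∣-m; ∣n⇒∣m*n)
open import Data.Integer.Properties
  using ( +-inverseʳ; +-assoc; +-comm; +-identityˡ; +-identityʳ; +-inverseˡ
        ; *-assoc; *-comm; *-identityˡ; *-identityʳ; *-distribˡ-+; *-distribʳ-+ )
open import Data.Integer.Tactic.RingSolver using (solve-∀)
open import Data.Nat using (ℕ; suc; _^_)
open import Data.Product using (_,_; Σ-syntax)
open import Data.Vec.Functional using (Vector)
open import Level using (Level; 0ℓ; _⊔_)
open import Relation.Binary.PropositionalEquality
  using (_≡_; refl; subst; sym)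

infix 4 _≡_[mod_]

_≡_[mod_] : ℤ → ℤ → ℕ → Set
i ≡ j [mod k ] = + k ∣ i - j

module _ {k : ℕ} where

  ≡-mod-reflexive : ∀ {i j} → i ≡ j → i ≡ j [mod k ]
  ≡-mod-reflexive {i} refl = divides 0ℤ (+-inverseʳ i)

  ≡-mod-sym : ∀ i j → i ≡ j [mod k ] → j ≡ i [mod k ]
  ≡-mod-sym i j h = subst (+ k ∣_) (eq i j) (∣m⇒∣-m h)
    where
    eq : ∀ i j → - (i - j) ≡ j - i
    eq = solve-∀

  ≡-mod-trans : ∀ i j l → i ≡ j [mod k ] → j ≡ l [mod k ] → i ≡ l [mod k ]
  ≡-mod-trans i j l h h′ = subst (+ k ∣_) (eq i j l) (∣m∣n⇒∣m+n h h′)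
    where
    eq : ∀ i j l → (i - j) + (j - l) ≡ i - l
    eq = solve-∀

  ≡-mod-+ : ∀ i i′ j j′ → i ≡ i′ [mod k ] → j ≡ j′ [mod k ] →
            i + j ≡ i′ + j′ [mod k ]
  ≡-mod-+ i i′ j j′ h h′ = subst (+ k ∣_) (eq i i′ j j′) (∣m∣n⇒∣m+n h h′)
    where
    eq : ∀ i i′ j j′ → (i - i′) + (j - j′) ≡ (i + j) - (i′ + j′)
    eq = solve-∀

  ≡-mod-* : ∀ i i′ j j′ → i ≡ i′ [mod k ] → j ≡ j′ [mod k ] →
            i * j ≡ i′ * j′ [mod k ]
  ≡-mod-* i i′ j j′ h h′ =
    subst (+ k ∣_) (eq i i′ j j′) (∣m∣n⇒∣m+n (∣n⇒∣m*n j h) (∣n⇒∣m*n i′ h′))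
    where
    eq : ∀ i i′ j j′ → j * (i - i′) + i′ * (j - j′) ≡ i * j - i′ * j′
    eq = solve-∀

  ≡-mod-neg : ∀ i j → i ≡ j [mod k ] → - i ≡ - j [mod k ]
  ≡-mod-neg i j h = subst (+ k ∣_) (eq i j) (∣m⇒∣-m h)
    where
    eq : ∀ i j → - (i - j) ≡ - i - - j
    eq = solve-∀

-- The p-adic integers are the inverse limit of the rings ℤ/pⁿ: an element is
-- a compatible family of residue classes, each given by an integer
-- representative, and two families are equal when they agree modulo every pⁿ.
-- The class with index n lives modulo pⁿ, so the one with index 0 carries no
-- information.
module PAdic (p : ℕ) where

  record Element : Set where
    constructor mk
    field
      approx     : ℕ → ℤ
      compatible : ∀ n → approx (suc n) ≡ approx n [mod p ^ n ]

  open Element public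

  -- A record rather than a function type, so that x and y can be inferred
  -- from the type x ≈ₚ y.
  infix 4 _≈ₚ_
  record _≈ₚ_ (x y : Element) : Set where
    constructor mk≈
    field
      approx-≈ : ∀ n → approx x n ≡ approx y n [mod p ^ n ]

  open _≈ₚ_ public

  infixl 6 _+ₚ_
  infixl 7 _*ₚ_
  infix  8 -ₚ_

  _+ₚ_ : Element → Element → Element
  x +ₚ y = mk (λ n → approx x n + approx y n)
    (λ n → ≡-mod-+ (approx x (suc n)) (approx x n) (approx y (suc n)) (approx y n)
             (compatible x n) (compatible y n))

  _*ₚ_ : Element → Element → Element
  x *ₚ y = mk (λ n → approx x n * approx y n)
    (λ n → ≡-mod-* (approx x (suc n)) (approx x n) (approx y (suc n)) (approx y n)
             (compatible x n) (compatible y n))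

  -ₚ_ : Element → Element
  -ₚ x = mk (λ n → - approx x n)
    (λ n → ≡-mod-neg (approx x (suc n)) (approx x n) (compatible x n))

  fromℤ : ℤ → Element
  fromℤ i = mk (λ _ → i) (λ _ → ≡-mod-reflexive {i = i} refl)

  0ₚ 1ₚ : Element
  0ₚ = fromℤ 0ℤ
  1ₚ = fromℤ 1ℤ

  pointwise : ∀ {x y} → (∀ n → approx x n ≡ approx y n) → x ≈ₚ y
  pointwise eq = mk≈ (λ n → ≡-mod-reflexive (eq n))

ℤₚ : ℕ → CommutativeRing 0ℓ 0ℓ
ℤₚ p = record
  { Carrier = Element
  ; _≈_ = _≈ₚ_
  ; _+_ = _+ₚ_
  ; _*_ = _*ₚ_
  ; -_  = -ₚ_
  ; 0#  = 0ₚ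
  ; 1#  = 1ₚ
  ; isCommutativeRing = record
    { isRing = record
      { +-isAbelianGroup = record
        { isGroup = record
          { isMonoid = record
            { isSemigroup = record
              { isMagma = record
                { isEquivalence = record
                  { refl  = pointwise (λ _ → refl)
                  ; sym   = λ {x} {y} h → mk≈ λ n →
                      ≡-mod-sym (approx x n) (approx y n) (approx-≈ h n)
                  ; trans = λ {x} {y} {z} h h′ → mk≈ λ n →
                      ≡-mod-trans (approx x n) (approx y n) (approx z n)
                        (approx-≈ h n) (approx-≈ h′ n)
                  }
                ; ∙-cong = λ {x} {x′} {y} {y′} h h′ → mk≈ λ n →
                    ≡-mod-+ (approx x n) (approx x′ n) (approx y n) (approx y′ n)
                      (approx-≈ h n) (approx-≈ h′ n)
                }
              ; assoc = λ x y z → pointwise λ n →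
                  +-assoc (approx x n) (approx y n) (approx z n)
              }
            ; identity = (λ x → pointwise λ n → +-identityˡ (approx x n))
                       , (λ x → pointwise λ n → +-identityʳ (approx x n))
            }
          ; inverse = (λ x → pointwise λ n → +-inverseˡ (approx x n))
                    , (λ x → pointwise λ n → +-inverseʳ (approx x n))
          ; ⁻¹-cong = λ {x} {y} h → mk≈ λ n →
              ≡-mod-neg (approx x n) (approx y n) (approx-≈ h n)
          }
        ; comm = λ x y → pointwise λ n → +-comm (approx x n) (approx y n)
        }
      ; *-cong = λ {x} {x′} {y} {y′} h h′ → mk≈ λ n →
          ≡-mod-* (approx x n) (approx x′ n) (approx y n) (approx y′ n)
            (approx-≈ h n) (approx-≈ h′ n)
      ; *-assoc = λ x y z → pointwise λ n →
          *-assoc (approx x n) (approx y n) (approx z n)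
      ; *-identity = (λ x → pointwise λ n → *-identityˡ (approx x n))
                   , (λ x → pointwise λ n → *-identityʳ (approx x n))
      ; distrib = (λ x y z → pointwise λ n →
                     *-distribˡ-+ (approx x n) (approx y n) (approx z n))
                , (λ x y z → pointwise λ n →
                     *-distribʳ-+ (approx x n) (approx y n) (approx z n))
      }
    ; *-comm = λ x y → pointwise λ n → *-comm (approx x n) (approx y n)
    }
  }
  where open PAdic p

module _ {c ℓ : Level} (R : CommutativeRing c ℓ) where
  private module R = CommutativeRing R

  IsUnit : R.Carrier → Set (c ⊔ ℓ)
  IsUnit = Algebra.Definitions.Invertible R._≈_ R.1# R._*_

module Matrices {c ℓ : Level} (R : CommutativeRing c ℓ) where
  private module R = CommutativeRing R
  open Algebra.Definitions.RawMonoid R.+-rawMonoid using (sum)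

  Matrix : ℕ → Set c
  Matrix n = Fin n → Fin n → R.Carrier

  module _ {n : ℕ} where

    infix  4 _≈ᴹ_
    infixl 6 _+ᴹ_
    infixl 7 _*ᴹ_ _·ᴹ_

    _≈ᴹ_ : Matrix n → Matrix n → Set ℓ
    A ≈ᴹ B = ∀ i j → A i j R.≈ B i j

    0ᴹ : Matrix n
    0ᴹ i j = R.0#

    _+ᴹ_ : Matrix n → Matrix n → Matrix n
    (A +ᴹ B) i j = A i j R.+ B i j

    _*ᴹ_ : Matrix n → Matrix n → Matrix n
    (A *ᴹ B) i j = sum (λ k → A i k R.* B k j)

    _·ᴹ_ : R.Carrier → Matrix n → Matrix n
    (r ·ᴹ A) i j = r R.* A i j

  +ᴹ-rawMonoid : ℕ → RawMonoid c ℓ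
  +ᴹ-rawMonoid n = record
    { Carrier = Matrix n ; _≈_ = _≈ᴹ_ ; _∙_ = _+ᴹ_ ; ε = 0ᴹ }

  sumᴹ : ∀ {n m} → Vector (Matrix n) m → Matrix n
  sumᴹ {n} = Algebra.Definitions.RawMonoid.sum (+ᴹ-rawMonoid n)

UniversalOverM : ∀ {c ℓ} (n : ℕ) (R : CommutativeRing c ℓ) {m : ℕ} →
                 Vector (CommutativeRing.Carrier R) m → Set (c ⊔ ℓ)
UniversalOverM n R {m} a =
  (A : Matrix n) →
  Σ[ X ∈ Vector (Matrix n) m ] A ≈ᴹ sumᴹ (λ i → a i ·ᴹ (X i *ᴹ X i))
  where open Matrices R

-- Write u and v for two unit coefficients, which suffice since the other
-- squares may be taken to be 0.  As 2 is invertible, A is congruent modulo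
-- scalar matrices to v Y for some Y of trace 1, and then v Y² = v Y - v det Y
-- differs from A by a scalar matrix.  Every scalar matrix has the form u X²,
-- because [[0,l],[1,0]] squares to l.
--
-- Conversely, if all coefficients except perhaps c are divisible by p, then
-- modulo p every matrix would have the form c X².  The nilpotent matrix
-- [[0,1],[0,0]] does not: modulo a prime, the vanishing of three entries of
-- c X² forces that of the fourth.

module Submission where

open import Defs
open import Algebra.Bundles using (CommutativeRing; CommutativeMonoid)
import Algebra.Properties.CommutativeMonoid.Sum
import Algebra.Properties.Ring
import Algebra.Solver.Ring.NaturalCoefficients.Default
open import Data.Fin using (Fin; zero; suc; punchIn; punchOut)
open import Data.Fin.Patterns using (0F; 1F)
open import Data.Fin.Properties
  using (_≟_; any?; punchIn-injective; punchIn-punchOut; punchInᵢ≢i)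
open import Data.Integer as ℤ using (ℤ; +_; 0ℤ; 1ℤ)
open import Data.Integer.DivMod using (_%ℕ_; _/ℕ_; n%ℕd<d; a≡a%ℕn+[a/ℕn]*n)
import Data.Integer.Divisibility.Signed as ℤ∣
import Data.Integer.Properties as ℤ
open import Data.Integer.Tactic.RingSolver using (solve-∀)
open import Data.Nat as ℕ using (ℕ; zero; suc; _≥_; _^_)
open import Data.Nat.Coprimality using (coprime-Bézout; prime⇒coprime)
open import Data.Nat.Divisibility using (_∣_; ∣-refl; ∣⇒≤)
open import Data.Nat.GCD using (module Bézout)
open import Data.Nat.Primality
  using (Prime; euclidsLemma; prime⇒nonZero; prime⇒nonTrivial)
import Data.Nat.Properties as ℕ
open import Data.Product using (_×_; _,_; ∃; ∃₂; proj₁; proj₂)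
open import Data.Sum using (_⊎_; inj₁; inj₂; [_,_]′; reduce)
open import Data.Vec.Functional using (Vector; removeAt; updateAt)
open import Data.Vec.Functional.Properties using (updateAt-updates; updateAt-minimal)
open import Function using (_∘_; const; id)
open import Function.Bundles using (_⇔_; mk⇔)
open import Level using (Level; _⊔_)
open import Relation.Binary.PropositionalEquality as ≡ using (_≡_; _≢_)
import Relation.Binary.Reasoning.Setoid
open import Relation.Nullary using (¬_; yes; no; contradiction)
open import Relation.Nullary.Decidable using (¬?; _×-dec_; decidable-stable)
open import Relation.Unary using (Pred; Decidable)

-- Exceptional indices, and sums with few nonzero terms.

private
  variable
    c ℓ ℓ′ : Level

-- Constructive form of counting the failures of `P`; later `P` is divisibility of a coefficient by
-- `p`.
two-or-all-but-one : ∀ {n} {P : Pred (Fin (suc n)) ℓ} → Decidable P →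
  (∃₂ λ i j → i ≢ j × ¬ P i × ¬ P j) ⊎ (∃ λ i → ∀ k → k ≢ i → P k)
two-or-all-but-one P? with any? (¬? ∘ P?)
-- With no failure at all, any index can play the exception; `zero` exists because the index set is
-- nonempty.
... | no ¬∃ = inj₂ (zero , λ k _ → decidable-stable (P? k) (λ ¬Pk → ¬∃ (k , ¬Pk)))
... | yes (i , ¬Pi) with any? (λ j → ¬? (i ≟ j) ×-dec ¬? (P? j))
...   | yes (j , i≢j , ¬Pj) = inj₁ (i , j , i≢j , ¬Pi , ¬Pj)
...   | no ¬∃ = inj₂ (i , λ k k≢i →
          decidable-stable (P? k) (λ ¬Pk → ¬∃ (k , k≢i ∘ ≡.sym , ¬Pk)))

module _ (M : CommutativeMonoid c ℓ) where
  open CommutativeMonoid M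
  open Algebra.Properties.CommutativeMonoid.Sum M

  sum-zero : ∀ {n} (f : Vector Carrier n) → (∀ k → f k ≈ ε) → sum f ≈ ε
  sum-zero {n} f f≈0 = trans (sum-cong-≋ f≈0) (sum-replicate-zero n)

  sum-supported-at : ∀ {n} (f : Vector Carrier n) i →
    (∀ k → k ≢ i → f k ≈ ε) → sum f ≈ f i
  sum-supported-at {suc n} f i f≈0 =
    trans (sum-remove {i = i} f)
      (trans (∙-congˡ (sum-zero (removeAt f i) (λ k → f≈0 _ (punchInᵢ≢i i k))))
        (identityʳ (f i)))

  sum-supported-at₂ : ∀ {n} (f : Vector Carrier n) {i j} → i ≢ j →
    (∀ k → k ≢ i → k ≢ j → f k ≈ ε) → sum f ≈ f i ∙ f j
  sum-supported-at₂ {suc n} f {i} {j} i≢j f≈0 =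
    trans (sum-remove {i = i} f) (∙-congˡ
      -- Once `i` is removed, the old index `j` sits at position `punchOut i≢j`.
      (trans (sum-supported-at (removeAt f i) (punchOut i≢j) λ k k≢ →
                f≈0 _ (punchInᵢ≢i i k) λ eq →
                k≢ (punchIn-injective i _ _ (≡.trans eq (≡.sym (punchIn-punchOut i≢j)))))
        (reflexive (≡.cong f (punchIn-punchOut i≢j)))))

-- Sufficiency, over any commutative ring in which 2 is a unit.

module _ (R : CommutativeRing c ℓ) where
  open CommutativeRing R
  open Matrices R
  open Algebra.Properties.CommutativeMonoid.Sum +-commutativeMonoid
  open Algebra.Properties.Ring ring using (-1*x≈-x)
  open Relation.Binary.Reasoning.Setoid setoid
  open Algebra.Solver.Ring.NaturalCoefficients.Default commutativeSemiring

  -- Passes from matrix sums to sums in the ring, where the commutative monoid lemmas apply;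
  -- `+ᴹ-rawMonoid` carries no laws.
  sumᴹ-lookup : ∀ {n m} (F : Vector (Matrix n) m) r s →
    sumᴹ F r s ≡ sum (λ k → F k r s)
  sumᴹ-lookup {m = zero}  F r s = ≡.refl
  sumᴹ-lookup {m = suc m} F r s = ≡.cong (_+_ (F 0F r s)) (sumᴹ-lookup (F ∘ suc) r s)

  ·ᴹ-0ᴹ² : ∀ {n} x → x ·ᴹ (0ᴹ {n} *ᴹ 0ᴹ) ≈ᴹ 0ᴹ
  ·ᴹ-0ᴹ² {n} x i j =
    trans (*-congˡ (sum-zero +-commutativeMonoid {n} _ (λ k → zeroˡ 0#))) (zeroʳ x)

  universal-if-universal₂ : ∀ {n m} (a : Vector Carrier m) {i j} → i ≢ j →
    (∀ (A : Matrix n) → ∃₂ λ X Y → A ≈ᴹ a i ·ᴹ (X *ᴹ X) +ᴹ a j ·ᴹ (Y *ᴹ Y)) →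
    UniversalOverM n R a
  universal-if-universal₂ {n} {m} a {i} {j} i≢j universal₂ A
    with X , Y , A≈ ← universal₂ A = Z , λ r s → begin
      A r s                        ≈⟨ A≈ r s ⟩
      term i X r s + term j Y r s
        ≡⟨ ≡.cong₂ (λ M N → term i M r s + term j N r s) Zi≡X Zj≡Y ⟨
      term i (Z i) r s + term j (Z j) r s
        ≈⟨ sum-supported-at₂ +-commutativeMonoid (λ k → term k (Z k) r s) i≢j (rest≈0 r s) ⟨
      sum (λ k → term k (Z k) r s) ≡⟨ sumᴹ-lookup (λ k → term k (Z k)) r s ⟨
      sumᴹ (λ k → term k (Z k)) r s ∎
    where
    term : Fin m → Matrix n → Matrix n
    term k M = a k ·ᴹ (M *ᴹ M)

    Z₀ Z : Vector (Matrix n) m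
    Z₀ = updateAt (λ _ → 0ᴹ) i (const X)
    Z  = updateAt Z₀ j (const Y)

    Zi≡X : Z i ≡ X
    Zi≡X = ≡.trans (updateAt-minimal i j Z₀ i≢j) (updateAt-updates i (λ _ → 0ᴹ))

    Zj≡Y : Z j ≡ Y
    Zj≡Y = updateAt-updates j Z₀

    rest≈0 : ∀ r s k → k ≢ i → k ≢ j → term k (Z k) r s ≈ 0#
    rest≈0 r s k k≢i k≢j = trans
      (reflexive (≡.cong (λ M → term k M r s)
        (≡.trans (updateAt-minimal k j Z₀ k≢j) (updateAt-minimal k i (λ _ → 0ᴹ) k≢i))))
      (·ᴹ-0ᴹ² (a k) r s)

  matrix₂ : (x y z w : Carrier) → Matrix 2
  matrix₂ x y z w 0F 0F = x
  matrix₂ x y z w 0F 1F = y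
  matrix₂ x y z w 1F 0F = z
  matrix₂ x y z w 1F 1F = w

  -- The difference of the diagonal entries of v Y² is that of v Y times the
  -- trace of Y.
  sum-of-squares-scalar-trace-1 : ∀ (A : Matrix 2) u v l o e y₁ y₂ y₃ y₄ →
    y₁ + y₄ ≈ 1# → A 0F 0F ≈ A 1F 1F + e → v * y₁ ≈ v * y₄ + e →
    v * y₂ ≈ A 0F 1F → v * y₃ ≈ A 1F 0F →
    u * (l * o) + v * (y₃ * y₂ + y₄ * y₄) ≈ A 1F 1F →
    let X = matrix₂ 0# l o 0#; Y = matrix₂ y₁ y₂ y₃ y₄ in
    A ≈ᴹ u ·ᴹ (X *ᴹ X) +ᴹ v ·ᴹ (Y *ᴹ Y)
  sum-of-squares-scalar-trace-1 A u v l o e y₁ y₂ y₃ y₄ tr≈1 a≈d+e vy₁≈ vy₂≈b vy₃≈c d≈ =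
    λ where
      0F 0F → begin
        A 0F 0F           ≈⟨ a≈d+e ⟩
        A 1F 1F + e       ≈⟨ +-cong d≈ (times-trace e) ⟨
        u * (l * o) + v * (y₃ * y₂ + y₄ * y₄) + e * (y₁ + y₄)
          ≈⟨ solve 8 (λ u l o v y₂ y₃ y₄ s →
                          u :* (l :* o) :+ v :* (y₃ :* y₂ :+ y₄ :* y₄) :+ s
                       := u :* (l :* o) :+ (v :* y₄ :* y₄ :+ s) :+ v :* (y₂ :* y₃))
               refl u l o v y₂ y₃ y₄ (e * (y₁ + y₄)) ⟩
        u * (l * o) + (v * y₄ * y₄ + e * (y₁ + y₄)) + v * (y₂ * y₃)
          ≈⟨ +-congʳ (+-congˡ vy₁²≈) ⟨
        u * (l * o) + v * y₁ * y₁ + v * (y₂ * y₃)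
          ≈⟨ solve 7 (λ u l o v y₁ y₂ y₃ →
                          u :* (l :* o) :+ v :* y₁ :* y₁ :+ v :* (y₂ :* y₃)
                       := u :* (con 0 :* con 0 :+ (l :* o :+ con 0))
                          :+ v :* (y₁ :* y₁ :+ (y₂ :* y₃ :+ con 0)))
               refl u l o v y₁ y₂ y₃ ⟩
        u * (0# * 0# + (l * o + 0#)) + v * (y₁ * y₁ + (y₂ * y₃ + 0#)) ∎
      -- The off-diagonal entries of `X *ᴹ X` vanish, and those of `Y *ᴹ Y` are those of `Y` times
      -- its trace `y₁ + y₄`.
      0F 1F → begin
        A 0F 1F           ≈⟨ vy₂≈b ⟨
        v * y₂            ≈⟨ times-trace (v * y₂) ⟨
        v * y₂ * (y₁ + y₄)
          ≈⟨ solve 6 (λ u l v y₁ y₂ y₄ → v :* y₂ :* (y₁ :+ y₄)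
                       := u :* (con 0 :* l :+ (l :* con 0 :+ con 0))
                          :+ v :* (y₁ :* y₂ :+ (y₂ :* y₄ :+ con 0)))
               refl u l v y₁ y₂ y₄ ⟩
        u * (0# * l + (l * 0# + 0#)) + v * (y₁ * y₂ + (y₂ * y₄ + 0#)) ∎
      1F 0F → begin
        A 1F 0F           ≈⟨ vy₃≈c ⟨
        v * y₃            ≈⟨ times-trace (v * y₃) ⟨
        v * y₃ * (y₁ + y₄)
          ≈⟨ solve 6 (λ u o v y₁ y₃ y₄ → v :* y₃ :* (y₁ :+ y₄)
                       := u :* (o :* con 0 :+ (con 0 :* o :+ con 0))
                          :+ v :* (y₃ :* y₁ :+ (y₄ :* y₃ :+ con 0)))
               refl u o v y₁ y₃ y₄ ⟩
        u * (o * 0# + (0# * o + 0#)) + v * (y₃ * y₁ + (y₄ * y₃ + 0#)) ∎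
      1F 1F → begin
        A 1F 1F           ≈⟨ d≈ ⟨
        u * (l * o) + v * (y₃ * y₂ + y₄ * y₄)
          ≈⟨ solve 7 (λ u l o v y₂ y₃ y₄ →
                          u :* (l :* o) :+ v :* (y₃ :* y₂ :+ y₄ :* y₄)
                       := u :* (o :* l :+ (con 0 :* con 0 :+ con 0))
                          :+ v :* (y₃ :* y₂ :+ (y₄ :* y₄ :+ con 0)))
               refl u l o v y₂ y₃ y₄ ⟩
        u * (o * l + (0# * 0# + 0#)) + v * (y₃ * y₂ + (y₄ * y₄ + 0#)) ∎
    where
    times-trace : ∀ x → x * (y₁ + y₄) ≈ x
    times-trace x = trans (*-congˡ tr≈1) (*-identityʳ x)

    -- The factorisation v(y₁² - y₄²) = v(y₁ - y₄)(y₁ + y₄), written without subtraction because the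
    -- solver works in commutative semirings.
    vy₁²≈ : v * y₁ * y₁ ≈ v * y₄ * y₄ + e * (y₁ + y₄)
    vy₁²≈ = begin
      v * y₁ * y₁                     ≈⟨ *-congʳ vy₁≈ ⟩
      (v * y₄ + e) * y₁
        ≈⟨ solve 4 (λ v y₁ y₄ e → (v :* y₄ :+ e) :* y₁ := v :* y₁ :* y₄ :+ e :* y₁)
             refl v y₁ y₄ e ⟩
      v * y₁ * y₄ + e * y₁            ≈⟨ +-congʳ (*-congʳ vy₁≈) ⟩
      (v * y₄ + e) * y₄ + e * y₁
        ≈⟨ solve 4 (λ v y₁ y₄ e → (v :* y₄ :+ e) :* y₄ :+ e :* y₁
                                := v :* y₄ :* y₄ :+ e :* (y₁ :+ y₄))
             refl v y₁ y₄ e ⟩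
      v * y₄ * y₄ + e * (y₁ + y₄)     ∎

  x-y+y≈x : ∀ x y → x - y + y ≈ x
  x-y+y≈x x y = trans (+-assoc x (- y) y)
    (trans (+-congˡ (-‿inverseˡ y)) (+-identityʳ x))

  cancel-inverse : ∀ {x x⁻¹} → x * x⁻¹ ≈ 1# → ∀ y → x * (x⁻¹ * y) ≈ y
  cancel-inverse xx⁻¹≈1 y =
    trans (sym (*-assoc _ _ y)) (trans (*-congʳ xx⁻¹≈1) (*-identityˡ y))

  universal₂ : IsUnit R (1# + 1#) → ∀ u v → IsUnit R u → IsUnit R v →
    (A : Matrix 2) → ∃₂ λ X Y → A ≈ᴹ u ·ᴹ (X *ᴹ X) +ᴹ v ·ᴹ (Y *ᴹ Y)
  universal₂ (½ , _ , 2½≈1) u v (u⁻¹ , _ , uu⁻¹≈1) (v⁻¹ , _ , vv⁻¹≈1) A =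
    matrix₂ 0# l 1# 0# , matrix₂ y₁ y₂ y₃ y₄ ,
    sum-of-squares-scalar-trace-1 A u v l 1# e y₁ y₂ y₃ y₄
      tr≈1
      (trans (sym (x-y+y≈x (A 0F 0F) (A 1F 1F))) (+-comm e (A 1F 1F)))
      (trans (distribˡ v y₄ t) (+-congˡ (cancel-inverse vv⁻¹≈1 e)))
      (cancel-inverse vv⁻¹≈1 (A 0F 1F))
      (cancel-inverse vv⁻¹≈1 (A 1F 0F))
      (trans (+-congʳ (trans (*-congˡ (*-identityʳ l)) (cancel-inverse uu⁻¹≈1 _)))
        (x-y+y≈x (A 1F 1F) (v * (y₃ * y₂ + y₄ * y₄))))
    where
    e t y₁ y₂ y₃ y₄ l : Carrier
    -- Agreement of `A` with v Y modulo scalars forces `y₂`, `y₃` and y₁ - y₄ = t. Trace 1 then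
    -- gives 2 y₄ = 1 - t. Finally `l` is the scalar still missing, divided by `u`.
    e  = A 0F 0F - A 1F 1F
    t  = v⁻¹ * e
    y₄ = ½ * (1# - t)
    y₁ = y₄ + t
    y₂ = v⁻¹ * A 0F 1F
    y₃ = v⁻¹ * A 1F 0F
    l  = u⁻¹ * (A 1F 1F - v * (y₃ * y₂ + y₄ * y₄))

    tr≈1 : y₁ + y₄ ≈ 1#
    tr≈1 = begin
      y₄ + t + y₄               ≈⟨ +-comm (y₄ + t) y₄ ⟩
      y₄ + (y₄ + t)             ≈⟨ +-assoc y₄ y₄ t ⟨
      y₄ + y₄ + t               ≈⟨ +-congʳ (+-cong (*-identityˡ y₄) (*-identityˡ y₄)) ⟨
      1# * y₄ + 1# * y₄ + t     ≈⟨ +-congʳ (distribʳ y₄ 1# 1#) ⟨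
      (1# + 1#) * y₄ + t        ≈⟨ +-congʳ (cancel-inverse 2½≈1 (1# - t)) ⟩
      1# - t + t                ≈⟨ x-y+y≈x 1# t ⟩
      1#                        ∎

  two-units⇒universal : IsUnit R (1# + 1#) → ∀ {m} (a : Vector Carrier m) →
    (∃₂ λ i j → i ≢ j × IsUnit R (a i) × IsUnit R (a j)) → UniversalOverM 2 R a
  two-units⇒universal 2-unit a (i , j , i≢j , ai-unit , aj-unit) =
    universal-if-universal₂ a i≢j (universal₂ 2-unit (a i) (a j) ai-unit aj-unit)

  -- Necessity, by working modulo a prime ideal.

  -- `P x` plays the role of x = 0 in a quotient domain, so that no quotient ring has to be formed.
  -- Closure under negation comes from `*-∈` with the factor `- 1#`.
  record IsPrimeIdeal (P : Pred Carrier ℓ′) : Set (c ⊔ ℓ ⊔ ℓ′) where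
    field
      resp    : ∀ {x y} → x ≈ y → P x → P y
      0∈      : P 0#
      1∉      : ¬ P 1#
      +-∈     : ∀ {x y} → P x → P y → P (x + y)
      *-∈     : ∀ x {y} → P y → P (x * y)
      prime-∈ : ∀ {x y} → P (x * y) → P x ⊎ P y

    *-∈ˡ : ∀ {x} y → P x → P (x * y)
    *-∈ˡ {x} y = resp (*-comm y x) ∘ *-∈ y

    sum-∈ : ∀ {n} (f : Vector Carrier n) → (∀ k → P (f k)) → P (sum f)
    sum-∈ {zero}  f f∈ = 0∈
    sum-∈ {suc n} f f∈ = +-∈ (f∈ 0F) (sum-∈ (f ∘ suc) (f∈ ∘ suc))

    +-cancelʳ-∈ : ∀ {x y} → P y → P (x + y) → P x
    +-cancelʳ-∈ {x} {y} y∈ x+y∈ = resp eq (+-∈ x+y∈ (*-∈ (- 1#) y∈))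
      where
      eq : x + y + - 1# * y ≈ x
      eq = begin
        x + y + - 1# * y  ≈⟨ +-congˡ (-1*x≈-x y) ⟩
        x + y + - y       ≈⟨ +-assoc x y (- y) ⟩
        x + (y - y)       ≈⟨ +-congˡ (-‿inverseʳ y) ⟩
        x + 0#            ≈⟨ +-identityʳ x ⟩
        x                 ∎

    square-∈ : ∀ {x} → P (x * x) → P x
    square-∈ = reduce ∘ prime-∈

    -- Unless `b` lies in `P`, the lower left entry puts z(x + w) in `P`. If x + w is in `P`, so is
    -- the upper right entry y(x + w). If `z` is, the diagonal entries leave x² and w² in `P`, hence
    -- `x` and `w`, and again x + w.
    nilpotent-∈ : ∀ b (X : Matrix 2) → let S = b ·ᴹ (X *ᴹ X) in
      P (S 0F 0F) → P (S 1F 0F) → P (S 1F 1F) → P (S 0F 1F)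
    nilpotent-∈ b X s₁∈ s₃∈ s₄∈ with prime-∈ s₁∈ | prime-∈ s₃∈ | prime-∈ s₄∈
    ... | inj₁ b∈ | _ | _ = *-∈ˡ _ b∈
    ... | _ | inj₁ b∈ | _ = *-∈ˡ _ b∈
    ... | _ | _ | inj₁ b∈ = *-∈ˡ _ b∈
    ... | inj₂ x²+yz∈ | inj₂ zx+wz∈ | inj₂ zy+w²∈ =
      *-∈ b (resp y[x+w] (y[x+w]∈ (prime-∈ (resp (sym z[x+w]) zx+wz∈))))
      where
      x = X 0F 0F
      y = X 0F 1F
      z = X 1F 0F
      w = X 1F 1F

      y[x+w] : y * (x + w) ≈ x * y + (y * w + 0#)
      y[x+w] = solve 3 (λ x y w → y :* (x :+ w) := x :* y :+ (y :* w :+ con 0)) refl x y w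

      z[x+w] : z * (x + w) ≈ z * x + (w * z + 0#)
      z[x+w] = solve 3 (λ x z w → z :* (x :+ w) := z :* x :+ (w :* z :+ con 0)) refl x z w

      y[x+w]∈ : P z ⊎ P (x + w) → P (y * (x + w))
      y[x+w]∈ (inj₂ x+w∈) = *-∈ y x+w∈
      y[x+w]∈ (inj₁ z∈)   = *-∈ y (+-∈
        (square-∈ (+-cancelʳ-∈ (+-∈ (*-∈ y z∈) 0∈) x²+yz∈))
        (square-∈ (+-cancelʳ-∈ (*-∈ˡ y z∈)
          (resp (trans (+-congˡ (+-identityʳ _)) (+-comm _ _)) zy+w²∈))))

    -- Modulo `P` only the term with index `i` survives, so `nilpotent-∈` applies to it and would
    -- put the entry `1#` of `N` in `P`.
    not-universal : ∀ {m} (a : Vector Carrier m) i → (∀ k → k ≢ i → P (a k)) →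
      ¬ UniversalOverM 2 R a
    not-universal {suc m} a i a∈ universal = 1∉ (resp (sym (decompose 0F 1F))
      (+-∈ (nilpotent-∈ (a i) (X i) (S∈ 0F 0F refl) (S∈ 1F 0F refl) (S∈ 1F 1F refl))
        (rest∈ 0F 1F)))
      where
      N : Matrix 2
      N 0F 1F = 1#
      N _  _  = 0#

      X : Vector (Matrix 2) (suc m)
      X = proj₁ (universal N)

      S : Fin (suc m) → Matrix 2
      S k = a k ·ᴹ (X k *ᴹ X k)

      rest : Matrix 2
      rest r s = sum (removeAt (λ k → S k r s) i)

      rest∈ : ∀ r s → P (rest r s)
      rest∈ r s = sum-∈ _ λ k → *-∈ˡ _ (a∈ _ (punchInᵢ≢i i k))

      decompose : ∀ r s → N r s ≈ S i r s + rest r s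
      decompose r s = trans (proj₂ (universal N) r s)
        (trans (reflexive (sumᴹ-lookup S r s)) (sum-remove {i = i} (λ k → S k r s)))

      S∈ : ∀ r s → N r s ≈ 0# → P (S i r s)
      S∈ r s N≈0 = +-cancelʳ-∈ (rest∈ r s) (resp (trans (sym N≈0) (decompose r s)) 0∈)

    -- Decidability of `P` turns the refutation of the one-exception case into two actual indices.
    universal⇒two-∉ : Decidable P → ∀ {m} (a : Vector Carrier (suc m)) →
      UniversalOverM 2 R a → ∃₂ λ i j → i ≢ j × ¬ P (a i) × ¬ P (a j)
    universal⇒two-∉ P? a universal =
      [ id , (λ (i , a∈) → contradiction universal (not-universal a i a∈)) ]′
        (two-or-all-but-one (P? ∘ a))

-- Congruences and inverses modulo powers.

≡-mod-∣ : ∀ {k l} i j → + k ℤ∣.∣ + l → i ≡ j [mod l ] → i ≡ j [mod k ]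
≡-mod-∣ i j = ℤ∣.∣-trans

≡-mod-1 : ∀ i j → i ≡ j [mod 1 ]
≡-mod-1 i j = ℤ∣.divides (i ℤ.- j) (≡.sym (ℤ.*-identityʳ (i ℤ.- j)))

-- Makes inverses chosen separately modulo successive powers of `p` compatible with one another.
inverse-unique-mod : ∀ {k} i j j′ → i ℤ.* j ≡ 1ℤ [mod k ] → i ℤ.* j′ ≡ 1ℤ [mod k ] →
  j ≡ j′ [mod k ]
inverse-unique-mod i j j′ ij≡1 ij′≡1 = ≡.subst (_ ℤ∣.∣_) (eq i j j′)
  (ℤ∣.∣m∣n⇒∣m-n (ℤ∣.∣n⇒∣m*n j′ ij≡1) (ℤ∣.∣n⇒∣m*n j ij′≡1))
  where
  eq : ∀ i j j′ → j′ ℤ.* (i ℤ.* j ℤ.- 1ℤ) ℤ.- j ℤ.* (i ℤ.* j′ ℤ.- 1ℤ) ≡ j ℤ.- j′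
  eq = solve-∀

*-mono-∣ : ∀ {k l} i j → + k ℤ∣.∣ i → + l ℤ∣.∣ j → + (k ℕ.* l) ℤ∣.∣ i ℤ.* j
*-mono-∣ {k} {l} i j k∣i l∣j = ≡.subst (ℤ∣._∣ i ℤ.* j) (≡.sym (ℤ.pos-* k l))
  (ℤ∣.∣-trans (ℤ∣.*-monoʳ-∣ (+ k) l∣j) (ℤ∣.*-monoˡ-∣ j k∣i))

-- A Newton-like step: replacing z by z + j(1 - iz) multiplies the error 1 - iz by 1 - ij, which is
-- divisible by `p`, so each step gains one power.
inverse-mod-^ : ∀ {p} i j → i ℤ.* j ≡ 1ℤ [mod p ] →
  ∀ n → ∃ λ z → i ℤ.* z ≡ 1ℤ [mod p ^ n ]
inverse-mod-^ i j ij≡1 zero = 0ℤ , ≡-mod-1 (i ℤ.* 0ℤ) 1ℤ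
inverse-mod-^ i j ij≡1 (suc n) with z , iz≡1 ← inverse-mod-^ i j ij≡1 n =
  z ℤ.+ j ℤ.* (1ℤ ℤ.- i ℤ.* z) ,
  ≡.subst (_ ℤ∣.∣_) (eq i j z)
    (ℤ∣.∣m⇒∣-m (*-mono-∣ (i ℤ.* j ℤ.- 1ℤ) (i ℤ.* z ℤ.- 1ℤ) ij≡1 iz≡1))
  where
  eq : ∀ i j z → ℤ.- ((i ℤ.* j ℤ.- 1ℤ) ℤ.* (i ℤ.* z ℤ.- 1ℤ)) ≡
                 i ℤ.* (z ℤ.+ j ℤ.* (1ℤ ℤ.- i ℤ.* z)) ℤ.- 1ℤ
  eq = solve-∀

-- Arithmetic modulo `p`, and the units of the p-adic integers.

module _ {p : ℕ} (p-prime : Prime p) where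
  open PAdic p

  private instance
    p≢0 : ℕ.NonZero p
    p≢0 = prime⇒nonZero p-prime

  euclidsLemmaℤ : ∀ i j → + p ℤ∣.∣ i ℤ.* j → + p ℤ∣.∣ i ⊎ + p ℤ∣.∣ j
  euclidsLemmaℤ i j p∣ij =
    [ inj₁ ∘ ℤ∣.∣ᵤ⇒∣ , inj₂ ∘ ℤ∣.∣ᵤ⇒∣ ]′
      (euclidsLemma ℤ.∣ i ∣ ℤ.∣ j ∣ p-prime (≡.subst (p ∣_) (ℤ.abs-* i j) (ℤ∣.∣⇒∣ᵤ p∣ij)))

  -- The remainder `r` of `i` is nonzero and below `p`, hence coprime to it, and Bézout applies.
  -- Over the naturals Bézout comes in two sign patterns, one per clause of `inverse`.
  inverse-mod-prime : ∀ i → ¬ + p ℤ∣.∣ i → ∃ λ j → i ℤ.* j ≡ 1ℤ [mod p ]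
  inverse-mod-prime i p∤i = inverse (coprime-Bézout (prime⇒coprime p-prime (n%ℕd<d i p)))
    where
    r = i %ℕ p
    q = i /ℕ p

    i≡r+qp : i ≡ + r ℤ.+ q ℤ.* + p
    i≡r+qp = a≡a%ℕn+[a/ℕn]*n i p

    instance
      r≢0 : ℕ.NonZero r
      r≢0 = ℕ.≢-nonZero λ r≡0 → p∤i (ℤ∣.divides q
        (≡.trans i≡r+qp (≡.trans (≡.cong (λ s → + s ℤ.+ q ℤ.* + p) r≡0) (ℤ.+-identityˡ _))))

    pos-identity : ∀ {x y k l} → 1 ℕ.+ x ℕ.* k ≡ y ℕ.* l → 1ℤ ℤ.+ + x ℤ.* + k ≡ + y ℤ.* + l
    pos-identity {x} {y} {k} {l} eq = ≡.trans (≡.cong (λ s → 1ℤ ℤ.+ s) (≡.sym (ℤ.pos-* x k)))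
      (≡.trans (≡.cong +_ eq) (ℤ.pos-* y l))

    inverse : Bézout.Identity 1 p r → ∃ λ j → i ℤ.* j ≡ 1ℤ [mod p ]
    -- Here 1 + y r = x p, so -y inverts `r` modulo `p`.
    inverse (Bézout.+- x y eq) = ℤ.- + y , ℤ∣.divides (ℤ.- (+ x ℤ.+ + y ℤ.* q)) (begin
      i ℤ.* ℤ.- + y ℤ.- 1ℤ
        ≡⟨ ≡.cong (λ s → s ℤ.* ℤ.- + y ℤ.- 1ℤ) i≡r+qp ⟩
      (+ r ℤ.+ q ℤ.* + p) ℤ.* ℤ.- + y ℤ.- 1ℤ
        ≡⟨ eq₁ (+ r) q (+ p) (+ y) ⟩
      ℤ.- ((1ℤ ℤ.+ + y ℤ.* + r) ℤ.+ + y ℤ.* q ℤ.* + p)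
        ≡⟨ ≡.cong (λ s → ℤ.- (s ℤ.+ + y ℤ.* q ℤ.* + p)) (pos-identity {y} {x} eq) ⟩
      ℤ.- (+ x ℤ.* + p ℤ.+ + y ℤ.* q ℤ.* + p)
        ≡⟨ eq₂ (+ x) (+ p) (+ y) q ⟩
      ℤ.- (+ x ℤ.+ + y ℤ.* q) ℤ.* + p ∎)
      where
      open ≡.≡-Reasoning
      eq₁ : ∀ r q p y → (r ℤ.+ q ℤ.* p) ℤ.* ℤ.- y ℤ.- 1ℤ ≡
                        ℤ.- ((1ℤ ℤ.+ y ℤ.* r) ℤ.+ y ℤ.* q ℤ.* p)
      eq₁ = solve-∀
      eq₂ : ∀ x p y q → ℤ.- (x ℤ.* p ℤ.+ y ℤ.* q ℤ.* p) ≡ ℤ.- (x ℤ.+ y ℤ.* q) ℤ.* p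
      eq₂ = solve-∀
    -- Here 1 + x p = y r, so `y` itself is the inverse.
    inverse (Bézout.-+ x y eq) = + y , ℤ∣.divides (+ x ℤ.+ q ℤ.* + y) (begin
      i ℤ.* + y ℤ.- 1ℤ
        ≡⟨ ≡.cong (λ s → s ℤ.* + y ℤ.- 1ℤ) i≡r+qp ⟩
      (+ r ℤ.+ q ℤ.* + p) ℤ.* + y ℤ.- 1ℤ
        ≡⟨ eq₁ (+ r) q (+ p) (+ y) ⟩
      + y ℤ.* + r ℤ.+ (q ℤ.* + p ℤ.* + y ℤ.- 1ℤ)
        ≡⟨ ≡.cong (ℤ._+ (q ℤ.* + p ℤ.* + y ℤ.- 1ℤ)) (≡.sym (pos-identity {x} {y} eq)) ⟩
      (1ℤ ℤ.+ + x ℤ.* + p) ℤ.+ (q ℤ.* + p ℤ.* + y ℤ.- 1ℤ)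
        ≡⟨ eq₂ (+ x) (+ p) (+ y) q ⟩
      (+ x ℤ.+ q ℤ.* + y) ℤ.* + p ∎)
      where
      open ≡.≡-Reasoning
      eq₁ : ∀ r q p y → (r ℤ.+ q ℤ.* p) ℤ.* y ℤ.- 1ℤ ≡ y ℤ.* r ℤ.+ (q ℤ.* p ℤ.* y ℤ.- 1ℤ)
      eq₁ = solve-∀
      eq₂ : ∀ x p y q → (1ℤ ℤ.+ x ℤ.* p) ℤ.+ (q ℤ.* p ℤ.* y ℤ.- 1ℤ) ≡
                        (x ℤ.+ q ℤ.* y) ℤ.* p
      eq₂ = solve-∀

  p∣p^suc : ∀ n → + p ℤ∣.∣ + (p ^ suc n)
  p∣p^suc n = ℤ∣.divides (+ (p ^ n)) (≡.trans (ℤ.pos-* p (p ^ n)) (ℤ.*-comm (+ p) (+ (p ^ n))))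

  p^n∣p^suc : ∀ n → + (p ^ n) ℤ∣.∣ + (p ^ suc n)
  p^n∣p^suc n = ℤ∣.divides (+ p) (ℤ.pos-* p (p ^ n))

  -- The elements of p ℤₚ.
  InMaximal : Element → Set
  InMaximal x = + p ℤ∣.∣ approx x 1

  inMaximal? : Decidable InMaximal
  inMaximal? x = + p ℤ∣.∣? approx x 1

  inMaximal-isPrimeIdeal : IsPrimeIdeal (ℤₚ p) InMaximal
  inMaximal-isPrimeIdeal = record
    { resp    = λ {x} {y} x≈y p∣x → ≡.subst (+ p ℤ∣.∣_) (eq (approx x 1) (approx y 1))
                  (ℤ∣.∣m∣n⇒∣m-n p∣x (ℤ∣.∣-trans (p∣p^suc 0) (approx-≈ x≈y 1)))
    ; 0∈      = ℤ∣.divides 0ℤ ≡.refl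
    ; 1∉      = λ p∣1 → ℕ.<⇒≱ (ℕ.nonTrivial⇒n>1 p {{prime⇒nonTrivial p-prime}})
                  (∣⇒≤ (ℤ∣.∣⇒∣ᵤ p∣1))
    ; +-∈     = ℤ∣.∣m∣n⇒∣m+n
    ; *-∈     = λ x → ℤ∣.∣n⇒∣m*n (approx x 1)
    ; prime-∈ = λ {x} {y} → euclidsLemmaℤ (approx x 1) (approx y 1)
    }
    where
    eq : ∀ i j → i ℤ.- (i ℤ.- j) ≡ j
    eq = solve-∀

  -- One inverse `j` of `approx x 1` modulo `p` starts the lifting at every level, since all later
  -- approximations agree with `approx x 1` modulo `p`. Two consecutive lifts both invert
  -- `approx x n` modulo `p ^ n`, so they agree there.
  notInMaximal⇒isUnit : ∀ x → ¬ InMaximal x → IsUnit (ℤₚ p) x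
  notInMaximal⇒isUnit x p∤x = x⁻¹ , trans (*-comm x⁻¹ x) xx⁻¹≈1 , xx⁻¹≈1
    where
    open CommutativeRing (ℤₚ p) using (trans; *-comm)

    j : ℤ
    j = proj₁ (inverse-mod-prime (approx x 1) p∤x)

    -- The indices start at 1: `approx x 0` is only meaningful modulo 1 and may be anything modulo
    -- `p`.
    xj≡1 : ∀ n → approx x (suc n) ℤ.* j ≡ 1ℤ [mod p ]
    xj≡1 zero    = proj₂ (inverse-mod-prime (approx x 1) p∤x)
    xj≡1 (suc n) = ≡-mod-trans (x₂ ℤ.* j) (x₁ ℤ.* j) 1ℤ
      (≡-mod-* x₂ x₁ j j (≡-mod-∣ x₂ x₁ (p∣p^suc n) (compatible x (suc n)))
        (≡-mod-reflexive {i = j} ≡.refl))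
      (xj≡1 n)
      where
      x₁ = approx x (suc n)
      x₂ = approx x (suc (suc n))

    inverse : ∀ n → ∃ λ z → approx x n ℤ.* z ≡ 1ℤ [mod p ^ n ]
    -- Modulo `p ^ 0`, which is 1, any integer serves as an inverse.
    inverse zero    = 0ℤ , ≡-mod-1 (approx x 0 ℤ.* 0ℤ) 1ℤ
    inverse (suc n) = inverse-mod-^ (approx x (suc n)) j (xj≡1 n) (suc n)

    x⁻¹ : Element
    x⁻¹ = mk (proj₁ ∘ inverse) λ n →
      let x₀ = approx x n; x₁ = approx x (suc n)
          z₀ = proj₁ (inverse n); z₁ = proj₁ (inverse (suc n))
      in inverse-unique-mod x₀ z₁ z₀
        (≡-mod-trans (x₀ ℤ.* z₁) (x₁ ℤ.* z₁) 1ℤ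
          (≡-mod-* x₀ x₁ z₁ z₁ (≡-mod-sym x₁ x₀ (compatible x n))
            (≡-mod-reflexive {i = z₁} ≡.refl))
          (≡-mod-∣ (x₁ ℤ.* z₁) 1ℤ (p^n∣p^suc n) (proj₂ (inverse (suc n)))))
        (proj₂ (inverse n))

    xx⁻¹≈1 : x *ₚ x⁻¹ ≈ₚ 1ₚ
    xx⁻¹≈1 = mk≈ (proj₂ ∘ inverse)

  -- Oddness enters here: a prime `p` dividing 2 is at most 2, hence equal to 2.
  two-isUnit : ¬ 2 ∣ p → IsUnit (ℤₚ p) (1ₚ +ₚ 1ₚ)
  two-isUnit 2∤p = notInMaximal⇒isUnit (1ₚ +ₚ 1ₚ) λ p∣2 →
    2∤p (≡.subst (_∣ p) (ℕ.≤-antisym (∣⇒≤ (ℤ∣.∣⇒∣ᵤ p∣2))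
      (ℕ.nonTrivial⇒n>1 p {{prime⇒nonTrivial p-prime}})) ∣-refl)

theorem2p3 : (p : ℕ) → Prime p → ¬ (2 ∣ p) →
    (m : ℕ) → m ≥ 1 →
    (a : Vector (CommutativeRing.Carrier (ℤₚ p)) m) →
    UniversalOverM 2 (ℤₚ p) a ⇔
    ∃₂ λ (i j : Fin m) → i ≢ j × IsUnit (ℤₚ p) (a i) × IsUnit (ℤₚ p) (a j)
-- The pattern `suc m` provides the nonempty index set on which the dichotomy rests.
theorem2p3 p p-prime 2∤p (suc m) _ a =
  mk⇔ two-units (two-units⇒universal (ℤₚ p) (two-isUnit p-prime 2∤p) a)
  where
  open IsPrimeIdeal (inMaximal-isPrimeIdeal p-prime) using (universal⇒two-∉)

  two-units : UniversalOverM 2 (ℤₚ p) a →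
    ∃₂ λ i j → i ≢ j × IsUnit (ℤₚ p) (a i) × IsUnit (ℤₚ p) (a j)
  two-units universal =
    let i , j , i≢j , ai∉ , aj∉ = universal⇒two-∉ (inMaximal? p-prime) a universal
    in i , j , i≢j , notInMaximal⇒isUnit p-prime (a i) ai∉ , notInMaximal⇒isUnit p-prime (a j) aj∉
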